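{- Let $T$ be a tournament on $n$ vertices. Then $u^{+}(T) \leq u^{ - }(T)$. In particular, $u^{+}(T) \leq n - \lfloor\log_2(n)\rfloor$.
   Context: The skew-adjacency matrix of a tournament with vertex set $\{v_1,\ldots,v_n\}$ is the $n\times n$ zero-diagonal matrix $S=[s_{ij}]$ in which $s_{ij}=1$ and $s_{ji}=-1$ if $v_i$ dominates $v_j$. A tournament is unimodular if the determinant of its skew-adjacency matrix is $1$ (by convention the empty tournament has determinant $1$, so it is unimodular). For a tournament $T$ on $n\ge 1$ vertices, $u^{+}(T)$ is the smallest number of vertices that must be added to $T$ to obtain a unimodular tournament, i.e. the smallest $k\ge 0$ such that some unimodular tournament on $n+k$ vertices contains $T$ as an induced subtournament; and $u^{ - }(T)$ is the smallest number of vertices that must be removed from $T$ to obtain a unimodular tournament. -}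

module Defs where

open import Data.Fin.Base using (Fin; zero; suc; toℕ; punchIn)
open import Data.Integer.Base using (ℤ; 0ℤ; 1ℤ; -1ℤ; _*_; _^_)
open import Data.Integer.Properties using (+-0-commutativeMonoid)
open import Data.Nat.Base as ℕ using (ℕ; zero; suc)
open import Data.Product.Base using (∃-syntax; _×_)
open import Level using (0ℓ; Level) renaming (suc to lsuc)
open import Relation.Binary.Core using (Rel)
open import Relation.Binary.Definitions using (Trichotomous; tri<; tri≈; tri>)
open import Relation.Binary.Morphism.Structures using (IsOrderMonomorphism)
open import Relation.Binary.PropositionalEquality.Core using (_≡_)
open import Relation.Unary using (Pred)

open import Algebra.Properties.CommutativeMonoid.Sum +-0-commutativeMonoid
  using (sum-syntax)

Matrix : ℕ → Set
Matrix n = Fin n → Fin n → ℤ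

-- Laplace expansion along the first row; the empty matrix has determinant 1.
det : ∀ {n} → Matrix n → ℤ
det {zero}  A = 1ℤ
det {suc n} A =
  ∑[ j < suc n ] (-1ℤ ^ toℕ j * A zero j * det (λ i k → A (suc i) (punchIn j k)))

-- Trichotomy with respect to equality says that no vertex dominates itself and
-- that of two distinct vertices exactly one dominates the other.
record Tournament (n : ℕ) : Set₁ where
  infix 4 _⟶_
  field
    _⟶_     : Rel (Fin n) 0ℓ
    compare : Trichotomous _≡_ _⟶_

skewAdjacency : ∀ {n} → Tournament n → Matrix n
skewAdjacency T i j with Tournament.compare T i j
... | tri< _ _ _ = 1ℤ
... | tri≈ _ _ _ = 0ℤ
... | tri> _ _ _ = -1ℤ

Unimodular : ∀ {n} → Tournament n → Set
Unimodular T = det (skewAdjacency T) ≡ 1ℤ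

-- S is (a copy of) an induced subtournament of T: there is an injection of
-- vertices that both preserves and reflects domination.
infix 4 _↪_
_↪_ : ∀ {m n} → Tournament m → Tournament n → Set
_↪_ {m} {n} S T =
  ∃[ f ] IsOrderMonomorphism {A = Fin m} {B = Fin n} _≡_ _≡_ S._⟶_ T._⟶_ f
  where
  module S = Tournament S
  module T = Tournament T

UnimodularAfterAdding : ∀ {n} → Tournament n → Pred ℕ (lsuc 0ℓ)
UnimodularAfterAdding {n} T k = ∃[ U ] Unimodular {n ℕ.+ k} U × T ↪ U

-- m is the number of vertices that remain; m = 0 (removing all of them) is allowed.
UnimodularAfterRemoving : ∀ {n} → Tournament n → Pred ℕ (lsuc 0ℓ)
UnimodularAfterRemoving {n} T k =
  ∃[ m ] m ℕ.+ k ≡ n × (∃[ U ] Unimodular {m} U × U ↪ T)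

IsSmallest : ∀ {ℓ : Level} → Pred ℕ ℓ → Pred ℕ ℓ
IsSmallest P k = P k × (∀ j → P j → k ℕ.≤ j)

-- u⁺(T) and u⁻(T) are given by their graphs: T HasU⁺ k means u⁺(T) = k.
infix 4 _HasU⁺_ _HasU⁻_

_HasU⁺_ : ∀ {n} → Tournament n → Pred ℕ (lsuc 0ℓ)
T HasU⁺ k = IsSmallest (UnimodularAfterAdding T) k

_HasU⁻_ : ∀ {n} → Tournament n → Pred ℕ (lsuc 0ℓ)
T HasU⁻ k = IsSmallest (UnimodularAfterRemoving T) k

{-# OPTIONS --safe #-}

-- Write v, v′ for twins: vertices with v ⟶ v′ that relate in the same way to every
-- other vertex. Expanding the determinant along the rows of v and v′ shows that
-- deleting both does not change it. Hence, if U ⊆ T is unimodular and T has k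
-- vertices outside U, adding a twin for each of these k vertices gives a tournament
-- with the determinant of U, and u⁺(T) ≤ u⁻(T). The first two vertices of a linear
-- order are twins, so linear orders of even size are unimodular; T contains a linear
-- order on 1 + ⌊log₂ n⌋ vertices, hence an even one on at least ⌊log₂ n⌋ vertices.
-- The minima u⁺ and u⁻ exist constructively because both predicates are decidable
-- by searching the finitely many tournaments and vertex maps of a given size.
module Submission where

open import Defs
open import Data.Bool.Base using (true; false)
open import Data.Fin.Base as Fin using (Fin; zero; suc; toℕ; punchIn; finToFun; funToFin)
import Data.Fin.Properties as Fin
open import Data.Integer.Base as ℤ using (ℤ; 0ℤ; 1ℤ; -1ℤ; _^_)
import Data.Integer.Properties as ℤ
open import Data.Integer.Tactic.RingSolver using (solve-∀)
open import Data.List.Base as List using ([]; _∷_; _∷ʳ_; length; filter; allFin)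
open import Data.List.Membership.Propositional.Properties using (∈-lookup)
open import Data.List.Properties using (length-tabulate; length-++)
open import Data.List.Relation.Unary.All as All using (All; []; _∷_)
import Data.List.Relation.Unary.All.Properties as All
open import Data.List.Relation.Unary.AllPairs using (AllPairs; []; _∷_)
import Data.List.Relation.Unary.AllPairs.Properties as AllPairs
open import Data.List.Relation.Unary.Unique.Propositional using (Unique)
import Data.List.Relation.Unary.Unique.Propositional.Properties as Unique
open import Data.Nat.Base as ℕ using (ℕ; zero; suc; NonZero; _∸_; _≤_; _<_; z≤n; s≤s; z<s; s<s; ⌊_/2⌋)
open import Data.Nat.Induction using (<-rec)
open import Data.Nat.Logarithm using (⌊log₂_⌋; ⌊log₂⌊n/2⌋⌋≡⌊log₂n⌋∸1)
import Data.Nat.Properties as ℕ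
open import Data.Product.Base using (∃-syntax; _×_; _,_; proj₁; proj₂)
open import Data.Sum.Base using (_⊎_; inj₁; inj₂)
open import Data.Unit.Base using (⊤; tt)
import Data.Vec.Functional as Vec
open import Function.Base using (_∘_; id)
open import Function.Definitions using (Injective)
open import Level using (0ℓ)
open import Relation.Binary.Consequences using (tri⇒irr; tri⇒asym; tri⇒dec<)
open import Relation.Binary.Core using (Rel)
import Relation.Binary.Definitions as B
open import Relation.Binary.Definitions using (Trichotomous; tri<; tri≈; tri>)
open import Relation.Binary.Morphism.Structures using (IsOrderMonomorphism)
open import Relation.Binary.PropositionalEquality
open import Relation.Nullary using (¬_; Dec; yes; no; contradiction; does)
open import Relation.Nullary.Decidable using (map′; _×-dec_; _→-dec_; ¬?)
open import Relation.Unary using (Pred; Decidable)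

open import Algebra.Properties.CommutativeMonoid.Sum ℤ.+-0-commutativeMonoid
  using (sum; sum-cong-≋; sum-replicate-zero)

private
  variable
    m n w : ℕ

-- Determinants with twin rows and columns.

minor : Matrix (suc n) → Fin (suc n) → Matrix n
minor A j i k = A (suc i) (punchIn j k)

det-cong : {A B : Matrix n} → (∀ i j → A i j ≡ B i j) → det A ≡ det B
det-cong {zero}  A≡B = refl
det-cong {suc n} A≡B = sum-cong-≋ λ j →
  cong₂ ℤ._*_ (cong (-1ℤ ^ toℕ j ℤ.*_) (A≡B zero j))
              (det-cong λ i k → A≡B (suc i) (punchIn j k))

sum-zero : {f : Fin n → ℤ} → (∀ i → f i ≡ 0ℤ) → sum f ≡ 0ℤ
sum-zero {n} f≡0 = trans (sum-cong-≋ f≡0) (sum-replicate-zero n)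

-- In the expansion along row 0 the first two terms cancel, since their minors agree; every later
-- minor still begins with two equal columns.
det-equal-columns : (A : Matrix (2 ℕ.+ n)) → (∀ i → A i zero ≡ A i (suc zero)) →
                    det A ≡ 0ℤ
det-equal-columns {n} A eq = begin
  det A ≡⟨⟩
  1ℤ ℤ.* A zero zero ℤ.* det (minor A zero) ℤ.+
    (-1ℤ ℤ.* A zero (suc zero) ℤ.* det (minor A (suc zero)) ℤ.+ sum rest)
    ≡⟨ cong₂ (λ a d → 1ℤ ℤ.* a ℤ.* d ℤ.+
                (-1ℤ ℤ.* A zero (suc zero) ℤ.* det (minor A (suc zero)) ℤ.+ sum rest))
             (eq zero) (det-cong minors) ⟩
  1ℤ ℤ.* a₁ ℤ.* d₁ ℤ.+ (-1ℤ ℤ.* a₁ ℤ.* d₁ ℤ.+ sum rest)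
    ≡⟨ cancel a₁ d₁ (sum rest) ⟩
  sum rest
    ≡⟨ sum-zero (λ j → trans (cong (c j ℤ.*_) (minor-zero A eq j)) (ℤ.*-zeroʳ (c j))) ⟩
  0ℤ ∎
  where
  open ≡-Reasoning
  a₁ d₁ : ℤ
  a₁ = A zero (suc zero)
  d₁ = det (minor A (suc zero))
  c : Fin n → ℤ
  c j = -1ℤ ^ toℕ (suc (suc j)) ℤ.* A zero (suc (suc j))
  rest : Fin n → ℤ
  rest j = c j ℤ.* det (minor A (suc (suc j)))
  minors : ∀ i k → minor A zero i k ≡ minor A (suc zero) i k
  minors i zero    = sym (eq (suc i))
  minors i (suc k) = refl
  cancel : ∀ a d r → 1ℤ ℤ.* a ℤ.* d ℤ.+ (-1ℤ ℤ.* a ℤ.* d ℤ.+ r) ≡ r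
  cancel = solve-∀
  -- An index `j` forces the size to be positive, which exposes the two leading columns of the
  -- minor.
  minor-zero : (A : Matrix (2 ℕ.+ m)) → (∀ i → A i zero ≡ A i (suc zero)) →
               ∀ j → det (minor A (suc (suc j))) ≡ 0ℤ
  minor-zero {suc _} A eq j = det-equal-columns (minor A (suc (suc j))) (eq ∘ suc)

module _ (A : Matrix (2 ℕ.+ n))
  (a₀₀ : A zero zero ≡ 0ℤ)        (a₀₁ : A zero (suc zero) ≡ 1ℤ)
  (a₁₀ : A (suc zero) zero ≡ -1ℤ) (a₁₁ : A (suc zero) (suc zero) ≡ 0ℤ)
  (rows : ∀ j → A zero (suc (suc j)) ≡ A (suc zero) (suc (suc j)))
  (cols : ∀ i → A (suc (suc i)) zero ≡ A (suc (suc i)) (suc zero))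
  where

  private
    R : Matrix n
    R i j = A (suc (suc i)) (suc (suc j))

    D : Fin n → ℤ
    D j = det (minor (minor A (suc zero)) (suc j))

    p b : Fin n → ℤ
    p j = -1ℤ ^ toℕ j
    b j = A (suc zero) (suc (suc j))

  -- Deleting a further column leaves the two equal columns 0 and 1 in place, so
  -- only the first term of the expansion along row 1 survives.
  det-minor-twins : ∀ j → det (minor A (suc (suc j))) ≡ ℤ.- D j
  det-minor-twins j = go A a₁₀ a₁₁ cols j
    where
    go : ∀ {n} (A : Matrix (2 ℕ.+ n)) →
         A (suc zero) zero ≡ -1ℤ → A (suc zero) (suc zero) ≡ 0ℤ →
         (∀ i → A (suc (suc i)) zero ≡ A (suc (suc i)) (suc zero)) →
         ∀ j → det (minor A (suc (suc j))) ≡ ℤ.- det (minor (minor A (suc zero)) (suc j))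
    go {suc n} A a₁₀ a₁₁ cols j = begin
      det M ≡⟨⟩
      1ℤ ℤ.* A (suc zero) zero ℤ.* det (minor M zero) ℤ.+
        (-1ℤ ℤ.* A (suc zero) (suc zero) ℤ.* det (minor M (suc zero)) ℤ.+ sum rest)
        ≡⟨ cong₂ (λ x y → 1ℤ ℤ.* x ℤ.* det (minor M zero) ℤ.+
                   (-1ℤ ℤ.* y ℤ.* det (minor M (suc zero)) ℤ.+ sum rest)) a₁₀ a₁₁ ⟩
      1ℤ ℤ.* -1ℤ ℤ.* det (minor M zero) ℤ.+
        (-1ℤ ℤ.* 0ℤ ℤ.* det (minor M (suc zero)) ℤ.+ sum rest)
        ≡⟨ cong₂ (λ d s → 1ℤ ℤ.* -1ℤ ℤ.* d ℤ.+
                   (-1ℤ ℤ.* 0ℤ ℤ.* det (minor M (suc zero)) ℤ.+ s))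
                 (det-cong first)
                 (sum-zero (λ l → trans (cong (c l ℤ.*_) (minor-zero A cols j l)) (ℤ.*-zeroʳ (c l)))) ⟩
      1ℤ ℤ.* -1ℤ ℤ.* d ℤ.+ (-1ℤ ℤ.* 0ℤ ℤ.* det (minor M (suc zero)) ℤ.+ 0ℤ)
        ≡⟨ simplify d (det (minor M (suc zero))) ⟩
      ℤ.- d ∎
      where
      open ≡-Reasoning
      M : Matrix (2 ℕ.+ n)
      M = minor A (suc (suc j))
      d : ℤ
      d = det (minor (minor A (suc zero)) (suc j))
      c rest : Fin n → ℤ
      c l = -1ℤ ^ toℕ (suc (suc l)) ℤ.* M zero (suc (suc l))
      rest l = c l ℤ.* det (minor M (suc (suc l)))
      first : ∀ i k → minor M zero i k ≡ minor (minor A (suc zero)) (suc j) i k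
      first i zero    = sym (cols i)
      first i (suc k) = refl
      simplify : ∀ d e → 1ℤ ℤ.* -1ℤ ℤ.* d ℤ.+ (-1ℤ ℤ.* 0ℤ ℤ.* e ℤ.+ 0ℤ) ≡ ℤ.- d
      simplify = solve-∀
      minor-zero : ∀ {n} (A : Matrix (3 ℕ.+ n)) →
                   (∀ i → A (suc (suc i)) zero ≡ A (suc (suc i)) (suc zero)) →
                   ∀ j l → det (minor (minor A (suc (suc j))) (suc (suc l))) ≡ 0ℤ
      minor-zero {suc _} A cols j l =
        det-equal-columns (minor (minor A (suc (suc j))) (suc (suc l))) cols

  -- The term of column 1 in row 0, expanded along row 1, contributes `det R - sum s`; the later
  -- terms of row 0 add up to `sum s` by `det-minor-twins`.
  det-twins : det A ≡ det R
  det-twins = begin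
    det A ≡⟨⟩
    1ℤ ℤ.* A zero zero ℤ.* d₀ ℤ.+
      (-1ℤ ℤ.* A zero (suc zero) ℤ.* (1ℤ ℤ.* A (suc zero) zero ℤ.* det R ℤ.+ sum s) ℤ.+ sum t)
      ≡⟨ cong₂ (λ x y → 1ℤ ℤ.* x ℤ.* d₀ ℤ.+
            (-1ℤ ℤ.* y ℤ.* (1ℤ ℤ.* A (suc zero) zero ℤ.* det R ℤ.+ sum s) ℤ.+ sum t))
          a₀₀ a₀₁ ⟩
    1ℤ ℤ.* 0ℤ ℤ.* d₀ ℤ.+
      (-1ℤ ℤ.* 1ℤ ℤ.* (1ℤ ℤ.* A (suc zero) zero ℤ.* det R ℤ.+ sum s) ℤ.+ sum t)
      ≡⟨ cong₂ (λ x y → 1ℤ ℤ.* 0ℤ ℤ.* d₀ ℤ.+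
            (-1ℤ ℤ.* 1ℤ ℤ.* (1ℤ ℤ.* x ℤ.* det R ℤ.+ sum s) ℤ.+ y))
          a₁₀ (sum-cong-≋ t≡s) ⟩
    1ℤ ℤ.* 0ℤ ℤ.* d₀ ℤ.+ (-1ℤ ℤ.* 1ℤ ℤ.* (1ℤ ℤ.* -1ℤ ℤ.* det R ℤ.+ sum s) ℤ.+ sum s)
      ≡⟨ simplify d₀ (det R) (sum s) ⟩
    det R ∎
    where
    open ≡-Reasoning
    d₀ : ℤ
    d₀ = det (minor A zero)
    s t : Fin n → ℤ
    s j = -1ℤ ℤ.* p j ℤ.* b j ℤ.* D j
    t j = -1ℤ ℤ.* (-1ℤ ℤ.* p j) ℤ.* A zero (suc (suc j)) ℤ.* det (minor A (suc (suc j)))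
    move-sign : ∀ p b d → -1ℤ ℤ.* (-1ℤ ℤ.* p) ℤ.* b ℤ.* (ℤ.- d) ≡ -1ℤ ℤ.* p ℤ.* b ℤ.* d
    move-sign = solve-∀
    t≡s : ∀ j → t j ≡ s j
    t≡s j = trans (cong₂ (λ x y → -1ℤ ℤ.* (-1ℤ ℤ.* p j) ℤ.* x ℤ.* y) (rows j) (det-minor-twins j))
                  (move-sign (p j) (b j) (D j))
    simplify : ∀ d r s → 1ℤ ℤ.* 0ℤ ℤ.* d ℤ.+
      (-1ℤ ℤ.* 1ℤ ℤ.* (1ℤ ℤ.* -1ℤ ℤ.* r ℤ.+ s) ℤ.+ s) ≡ r
    simplify = solve-∀

-- Skew-adjacency and monotone maps.

module _ (T : Tournament n) where
  open Tournament T

  irrefl : ∀ {i} → ¬ (i ⟶ i)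
  irrefl = tri⇒irr compare refl

  asym : B.Asymmetric _⟶_
  asym = tri⇒asym compare

  ⟶-dec : B.Decidable _⟶_
  ⟶-dec = tri⇒dec< compare

  skew-⟶ : ∀ {i j} → i ⟶ j → skewAdjacency T i j ≡ 1ℤ
  skew-⟶ {i} {j} i⟶j with compare i j
  ... | tri< _ _ _ = refl
  ... | tri≈ ¬p _ _ = contradiction i⟶j ¬p
  ... | tri> ¬p _ _ = contradiction i⟶j ¬p

  skew-⟵ : ∀ {i j} → j ⟶ i → skewAdjacency T i j ≡ -1ℤ
  skew-⟵ {i} {j} j⟶i with compare i j
  ... | tri< _ _ ¬p = contradiction j⟶i ¬p
  ... | tri≈ _ _ ¬p = contradiction j⟶i ¬p
  ... | tri> _ _ _ = refl

  skew-diagonal : ∀ i → skewAdjacency T i i ≡ 0ℤ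
  skew-diagonal i with compare i i
  ... | tri< _ i≢i _ = contradiction refl i≢i
  ... | tri≈ _ _ _ = refl
  ... | tri> _ i≢i _ = contradiction refl i≢i

infix 4 _⟪_⟫_
-- Between tournaments, trichotomy turns mere preservation into injectivity and reflection.
_⟪_⟫_ : (S : Tournament m) → (Fin m → Fin n) → Tournament n → Set
S ⟪ f ⟫ T = ∀ {i j} → Tournament._⟶_ S i j → Tournament._⟶_ T (f i) (f j)

module _ (S : Tournament m) (T : Tournament n) {f : Fin m → Fin n} (mono : S ⟪ f ⟫ T) where
  private
    module S = Tournament S
    module T = Tournament T

  mono⇒injective : Injective _≡_ _≡_ f
  mono⇒injective {i} {j} fi≡fj with S.compare i j
  ... | tri< i⟶j _ _ = contradiction (mono i⟶j) (tri⇒irr T.compare fi≡fj)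
  ... | tri≈ _ i≡j _ = i≡j
  ... | tri> _ _ j⟶i = contradiction (mono j⟶i) (tri⇒irr T.compare (sym fi≡fj))

  mono⇒cancel : Injective S._⟶_ T._⟶_ f
  mono⇒cancel {i} {j} fi⟶fj with S.compare i j
  ... | tri< i⟶j _ _ = i⟶j
  ... | tri≈ _ refl _ = contradiction fi⟶fj (irrefl T)
  ... | tri> _ _ j⟶i = contradiction (mono j⟶i) (asym T fi⟶fj)

  mono⇒↪ : S ↪ T
  mono⇒↪ = f , record
    { isOrderHomomorphism = record { cong = cong f ; mono = mono }
    ; injective = mono⇒injective
    ; cancel = mono⇒cancel
    }

  skew-mono : ∀ i j → skewAdjacency S i j ≡ skewAdjacency T (f i) (f j)
  skew-mono i j with S.compare i j
  ... | tri< i⟶j _ _ = sym (skew-⟶ T (mono i⟶j))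
  ... | tri≈ _ refl _ = sym (skew-diagonal T (f i))
  ... | tri> _ _ j⟶i = sym (skew-⟵ T (mono j⟶i))

↪⇒mono : {S : Tournament m} {T : Tournament n} ((f , _) : S ↪ T) → S ⟪ f ⟫ T
↪⇒mono (_ , f-emb) = f-emb .IsOrderMonomorphism.mono

-- Deleting twins: linear orders and blowups.

-- `S` only has to map monotonically onto the vertices after the twins, so it may be constructed
-- independently of `U`.
det-skew-twins : (S : Tournament m) (U : Tournament (2 ℕ.+ m)) →
  let open Tournament U in
  S ⟪ (λ i → suc (suc i)) ⟫ U →
  zero ⟶ suc zero →
  (∀ i → (zero ⟶ suc (suc i) × suc zero ⟶ suc (suc i)) ⊎
         (suc (suc i) ⟶ zero × suc (suc i) ⟶ suc zero)) →
  det (skewAdjacency U) ≡ det (skewAdjacency S)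
det-skew-twins S U mono 0⟶1 twins = trans
  (det-twins (skewAdjacency U)
    (skew-diagonal U zero) (skew-⟶ U 0⟶1) (skew-⟵ U 0⟶1) (skew-diagonal U (suc zero))
    rows cols)
  (sym (det-cong (skew-mono S U mono)))
  where
  rows : ∀ j → skewAdjacency U zero (suc (suc j)) ≡ skewAdjacency U (suc zero) (suc (suc j))
  rows j with twins j
  ... | inj₁ (p , q) = trans (skew-⟶ U p) (sym (skew-⟶ U q))
  ... | inj₂ (p , q) = trans (skew-⟵ U p) (sym (skew-⟵ U q))
  cols : ∀ i → skewAdjacency U (suc (suc i)) zero ≡ skewAdjacency U (suc (suc i)) (suc zero)
  cols i with twins i
  ... | inj₁ (p , q) = trans (skew-⟵ U p) (sym (skew-⟵ U q))
  ... | inj₂ (p , q) = trans (skew-⟶ U p) (sym (skew-⟶ U q))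

linear : ∀ n → Tournament n
linear n = record { _⟶_ = Fin._<_ ; compare = Fin.<-cmp }

-- `suc h * 2` reduces to `2 + h * 2`, so the vertices 0 and 1 can be split off as twins.
linear-even-unimodular : ∀ h → Unimodular (linear (h ℕ.* 2))
linear-even-unimodular zero    = refl
linear-even-unimodular (suc h) = trans
  (det-skew-twins (linear (h ℕ.* 2)) (linear (suc h ℕ.* 2)) (λ i<j → s<s (s<s i<j)) z<s
    (λ _ → inj₁ (z<s , s<s z<s)))
  (linear-even-unimodular h)

module _ (T : Tournament n) where
  open Tournament T

  -- The vertices i with the same image v under L are copies of v, and they
  -- dominate each other in the order of their indices.
  blowup : (Fin w → Fin n) → Tournament w
  blowup {w} L = record { _⟶_ = _⊳_ ; compare = cmp }
    where
    _⊳_ : Rel (Fin w) 0ℓ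
    i ⊳ j = L i ⟶ L j ⊎ (L i ≡ L j × i Fin.< j)
    cmp : Trichotomous _≡_ _⊳_
    cmp i j with compare (L i) (L j)
    ... | tri< i⟶j i≢j j↛i = tri< (inj₁ i⟶j) (i≢j ∘ cong L)
      λ { (inj₁ j⟶i) → j↛i j⟶i ; (inj₂ (j≡i , _)) → i≢j (sym j≡i) }
    ... | tri> i↛j i≢j j⟶i = tri>
      (λ { (inj₁ i⟶j) → i↛j i⟶j ; (inj₂ (i≡j , _)) → i≢j i≡j }) (i≢j ∘ cong L) (inj₁ j⟶i)
    ... | tri≈ i↛j Li≡Lj j↛i with Fin.<-cmp i j
    ...   | tri< i<j i≢j j≮i = tri< (inj₂ (Li≡Lj , i<j)) i≢j
      λ { (inj₁ j⟶i) → j↛i j⟶i ; (inj₂ (_ , j<i)) → j≮i j<i }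
    ...   | tri≈ i≮j i≡j j≮i = tri≈
      (λ { (inj₁ i⟶j) → i↛j i⟶j ; (inj₂ (_ , i<j)) → i≮j i<j }) i≡j
      (λ { (inj₁ j⟶i) → j↛i j⟶i ; (inj₂ (_ , j<i)) → j≮i j<i })
    ...   | tri> i≮j i≢j j<i = tri>
      (λ { (inj₁ i⟶j) → i↛j i⟶j ; (inj₂ (_ , i<j)) → i≮j i<j }) i≢j (inj₂ (sym Li≡Lj , j<i))

  -- As `L` avoids `v`, every other vertex compares with both copies of `v` as `T` dictates, so the
  -- copies are twins.
  det-skew-double : (L : Fin w → Fin n) (v : Fin n) → (∀ i → L i ≢ v) →
    det (skewAdjacency (blowup (v Vec.∷ v Vec.∷ L))) ≡ det (skewAdjacency (blowup L))
  det-skew-double L v v∉L = det-skew-twins (blowup L) (blowup (v Vec.∷ v Vec.∷ L))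
    (λ { (inj₁ i⟶j) → inj₁ i⟶j ; (inj₂ (eq , i<j)) → inj₂ (eq , s<s (s<s i<j)) })
    (inj₂ (refl , z<s))
    twins
    where
    twins : ∀ i → _
    twins i with compare v (L i)
    ... | tri< v⟶i _ _ = inj₁ (inj₁ v⟶i , inj₁ v⟶i)
    ... | tri≈ _ v≡i _ = contradiction (sym v≡i) (v∉L i)
    ... | tri> _ _ i⟶v = inj₂ (inj₁ i⟶v , inj₁ i⟶v)

-- Counting with maps between finite sets.

-- If `C` were onto, choosing preimages would inject `Fin n` into the smaller `Fin m`.
missing : {C : Fin m → Fin n} → m < n → ∃[ v ] (∀ i → C i ≢ v)
missing {m} {n} {C} m<n with Fin.all? (λ v → Fin.any? (λ i → C i Fin.≟ v))
... | no  ¬onto = let v , ∄i = Fin.¬∀⟶∃¬ n _ (λ v → Fin.any? (λ i → C i Fin.≟ v)) ¬onto in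
                  v , λ i eq → ∄i (i , eq)
... | yes onto = contradiction (Fin.injective⇒≤ section-injective) (ℕ.<⇒≱ m<n)
  where
  section-injective : Injective _≡_ _≡_ (proj₁ ∘ onto)
  section-injective {u} {v} eq = trans (sym (proj₂ (onto u))) (trans (cong C eq) (proj₂ (onto v)))

∷-injective : {C : Fin m → Fin n} {v : Fin n} → (∀ i → C i ≢ v) →
              Injective _≡_ _≡_ C → Injective _≡_ _≡_ (v Vec.∷ C)
∷-injective v∉C inj {zero}  {zero}  _  = refl
∷-injective v∉C inj {zero}  {suc j} eq = contradiction (sym eq) (v∉C j)
∷-injective v∉C inj {suc i} {zero}  eq = contradiction eq (v∉C i)
∷-injective v∉C inj {suc i} {suc j} eq = cong suc (inj eq)

-- Prepending a missed value to `C` would inject `Fin (suc n)` into `Fin n`.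
injective⇒onto : {C : Fin n → Fin n} → Injective _≡_ _≡_ C → ∀ v → ∃[ i ] C i ≡ v
injective⇒onto {C = C} inj v with Fin.any? (λ i → C i Fin.≟ v)
... | yes hit = hit
... | no  ∄i  = contradiction
  (Fin.injective⇒≤ (∷-injective (λ i eq → ∄i (i , eq)) inj)) ℕ.1+n≰n

-- Adding twins for the missing vertices.

module _ (T : Tournament n) where
  open Tournament T

  onto⇒↪blowup : (L : Fin w → Fin n) → (∀ v → ∃[ j ] L j ≡ v) → T ↪ blowup T L
  onto⇒↪blowup L onto = mono⇒↪ T (blowup T L) {f = proj₁ ∘ onto}
    λ {u} {v} u⟶v → inj₁ (subst₂ _⟶_ (sym (proj₂ (onto u))) (sym (proj₂ (onto v))) u⟶v)

  -- C enumerates the image of L without repetition, so that m counts the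
  -- vertices of T already covered.
  double-missing : ∀ k {m w} → m ℕ.+ k ≡ n → (C : Fin m → Fin n) (L : Fin w → Fin n) →
    Injective _≡_ _≡_ C → (∀ i → ∃[ j ] L j ≡ C i) → (∀ j → ∃[ i ] C i ≡ L j) →
    Unimodular (blowup T L) → ∃[ U ] Unimodular {w ℕ.+ (k ℕ.+ k)} U × T ↪ U
  double-missing zero {m} {w} m+0≡n C L inj C⊆L L⊆C det≡1
    rewrite ℕ.+-identityʳ m | ℕ.+-identityʳ w with refl ← m+0≡n
    -- Now `m` is `n`, so the injection `C` is onto and `L` covers every vertex.
    = blowup T L , det≡1 , onto⇒↪blowup L λ v →
        let i , Ci≡v = injective⇒onto inj v
            j , Lj≡Ci = C⊆L i
        in j , trans Lj≡Ci Ci≡v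
  double-missing (suc k) {m} {w} m+k≡n C L inj C⊆L L⊆C det≡1 =
    subst (λ s → ∃[ U ] Unimodular {s} U × T ↪ U) size
      -- The missing `v` enters `C` once and `L` twice, as a pair of twins.
      (double-missing k (trans (sym (ℕ.+-suc m k)) m+k≡n) (v Vec.∷ C) (v Vec.∷ v Vec.∷ L)
        (∷-injective v∉C inj)
        (λ { zero → zero , refl ; (suc i) → let j , eq = C⊆L i in suc (suc j) , eq })
        (λ { zero → zero , refl ; (suc zero) → zero , refl
           ; (suc (suc j)) → let i , eq = L⊆C j in suc i , eq })
        (trans (det-skew-double T L v v∉L) det≡1))
    where
    m<n : m < n
    m<n = subst (m <_) m+k≡n (ℕ.m<m+n m z<s)
    v : Fin n
    v = proj₁ (missing {C = C} m<n)
    v∉C : ∀ i → C i ≢ v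
    v∉C = proj₂ (missing {C = C} m<n)
    v∉L : ∀ j → L j ≢ v
    v∉L j Lj≡v = let i , Ci≡Lj = L⊆C j in v∉C i (trans Ci≡Lj Lj≡v)
    size : 2 ℕ.+ w ℕ.+ (k ℕ.+ k) ≡ w ℕ.+ (suc k ℕ.+ suc k)
    size = sym (trans (cong (w ℕ.+_) (cong suc (ℕ.+-suc k k)))
           (trans (ℕ.+-suc w _) (cong suc (ℕ.+-suc w _))))

  removing⇒adding : ∀ {k} → UnimodularAfterRemoving T k → UnimodularAfterAdding T k
  removing⇒adding {k} (m , m+k≡n , U , det≡1 , f , f-emb) =
    subst (λ s → ∃[ V ] Unimodular {s} V × T ↪ V) size
      -- `f` serves as both `C` and `L`, since `blowup T f` is a copy of `U`; two copies of each of
      -- the `k` other vertices give `m + 2k = n + k` vertices.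
      (double-missing k m+k≡n f f injective (λ i → i , refl) (λ i → i , refl)
        (trans (sym (det-cong (skew-mono U (blowup T f) {id} (λ i⟶j → inj₁ (mono i⟶j))))) det≡1))
    where
    open IsOrderMonomorphism f-emb using (injective; mono)
    size : m ℕ.+ (k ℕ.+ k) ≡ n ℕ.+ k
    size = trans (sym (ℕ.+-assoc m k k)) (cong (ℕ._+ k) m+k≡n)

-- Linear orders of logarithmic size inside a tournament.

length-filter-∁ : ∀ {A : Set} {P : Pred A 0ℓ} (P? : Decidable P) xs →
                  length (filter P? xs) ℕ.+ length (filter (¬? ∘ P?) xs) ≡ length xs
length-filter-∁ P? [] = refl
length-filter-∁ P? (x ∷ xs) with ih ← length-filter-∁ P? xs | does (P? x)
... | true  = cong suc ih
... | false = trans (ℕ.+-suc _ _) (cong suc ih)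

AllPairs-lookup : ∀ {A : Set} {R : Rel A 0ℓ} {xs} → AllPairs R xs →
                  ∀ {i j} → i Fin.< j → R (List.lookup xs i) (List.lookup xs j)
AllPairs-lookup (px ∷ _)   {zero}  {suc j} _         = All.lookup px (∈-lookup j)
AllPairs-lookup (_  ∷ pxs) {suc i} {suc j} (s<s i<j) = AllPairs-lookup pxs i<j

-- For `n` at least 2, halving lowers the logarithm by one, and doubling `⌊ n /2⌋` stays within `n`.
2^⌊log₂n⌋≤n : ∀ n .{{_ : NonZero n}} → 2 ℕ.^ ⌊log₂ n ⌋ ≤ n
2^⌊log₂n⌋≤n = <-rec (λ n → .{{_ : NonZero n}} → 2 ℕ.^ ⌊log₂ n ⌋ ≤ n) step
  where
  -- Only an inequality, because truncated subtraction keeps the exponent 0.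
  2^-pred : ∀ k → 2 ℕ.^ k ≤ 2 ℕ.* 2 ℕ.^ (k ∸ 1)
  2^-pred zero    = s≤s z≤n
  2^-pred (suc k) = ℕ.≤-refl
  step : ∀ n → (∀ {m} → m < n → .{{_ : NonZero m}} → 2 ℕ.^ ⌊log₂ m ⌋ ≤ m) →
         .{{_ : NonZero n}} → 2 ℕ.^ ⌊log₂ n ⌋ ≤ n
  step 1 rec = ℕ.≤-refl
  step n@(suc (suc n′)) rec = begin
    2 ℕ.^ ⌊log₂ n ⌋               ≤⟨ 2^-pred ⌊log₂ n ⌋ ⟩
    2 ℕ.* 2 ℕ.^ (⌊log₂ n ⌋ ∸ 1)   ≡⟨ cong (λ l → 2 ℕ.* 2 ℕ.^ l) (⌊log₂⌊n/2⌋⌋≡⌊log₂n⌋∸1 n) ⟨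
    2 ℕ.* 2 ℕ.^ ⌊log₂ ⌊ n /2⌋ ⌋   ≤⟨ ℕ.*-monoʳ-≤ 2 (rec (ℕ.⌊n/2⌋<n (suc n′))) ⟩
    2 ℕ.* ⌊ n /2⌋                 ≡⟨ cong (⌊ n /2⌋ ℕ.+_) (ℕ.+-identityʳ ⌊ n /2⌋) ⟩
    ⌊ n /2⌋ ℕ.+ ⌊ n /2⌋           ≤⟨ ℕ.+-monoʳ-≤ ⌊ n /2⌋ (ℕ.⌊n/2⌋≤⌈n/2⌉ n) ⟩
    ⌊ n /2⌋ ℕ.+ ℕ.⌈ n /2⌉         ≡⟨ ℕ.⌊n/2⌋+⌈n/2⌉≡n n ⟩
    n                             ∎
    where open ℕ.≤-Reasoning

-- One of two consecutive numbers is even; the slack of one matches the chain on `1 + ⌊log₂ n⌋`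
-- vertices.
even-above : ∀ l → ∃[ h ] l ≤ h ℕ.* 2 × h ℕ.* 2 ≤ suc l
even-above 0 = 0 , z≤n , z≤n
even-above 1 = 1 , s≤s z≤n , ℕ.≤-refl
even-above (suc (suc l)) = let h , l≤2h , 2h≤1+l = even-above l in
  suc h , s≤s (s≤s l≤2h) , s≤s (s≤s 2h≤1+l)

module _ (T : Tournament n) where
  open Tournament T

  -- The first vertex of xs dominates, or is dominated by, at least half of the others.
  chain : ∀ k {P : Pred (Fin n) 0ℓ} xs → Unique xs → All P xs → 2 ℕ.^ k ≤ length xs →
          ∃[ zs ] AllPairs _⟶_ zs × All P zs × length zs ≡ suc k
  chain zero    (x ∷ xs) _ (Px ∷ _) _ = x ∷ [] , [] ∷ [] , Px ∷ [] , refl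
  chain (suc k) [] _ _ 2^k≤0 = contradiction 2^k≤0 (ℕ.<⇒≱ (ℕ.m^n>0 2 (suc k)))
  chain (suc k) {P} (x ∷ xs) (x∉xs ∷ uniq) (Px ∷ Pxs) 2^k≤xs
    with 2 ℕ.^ k ℕ.≤? length (filter (⟶-dec T x) xs)
  ... | yes 2^k≤outs =
    -- Strengthening `P` by `x ⟶ y` makes the recursive chain remember that `x` dominates all of it.
    let zs , zs-chain , Pzs , |zs| = chain k {λ y → P y × x ⟶ y} outs
          (Unique.filter⁺ (⟶-dec T x) uniq)
          (All.zip (All.filter⁺ (⟶-dec T x) Pxs , All.all-filter (⟶-dec T x) xs))
          2^k≤outs
    in x ∷ zs , All.map proj₂ Pzs ∷ zs-chain , Px ∷ All.map proj₁ Pzs , cong suc |zs|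
    where
    outs = filter (⟶-dec T x) xs
  ... | no  2^k≰outs =
    let zs , zs-chain , Pzs , |zs| = chain k {λ y → P y × y ⟶ x} ins
          (Unique.filter⁺ ∁x⟶? uniq)
          (All.zip (All.filter⁺ ∁x⟶? Pxs
                   , All.zipWith (λ (x≢y , x↛y) → dominated x≢y x↛y)
                       (All.filter⁺ ∁x⟶? x∉xs , All.all-filter ∁x⟶? xs)))
          2^k≤ins
    in zs ∷ʳ x
     , AllPairs.++⁺ zs-chain ([] ∷ []) (All.map (λ (_ , y⟶x) → y⟶x ∷ []) Pzs)
     , All.++⁺ (All.map proj₁ Pzs) (Px ∷ [])
     , trans (length-++ zs) (trans (ℕ.+-comm _ 1) (cong suc |zs|))
    where
    ∁x⟶? = ¬? ∘ ⟶-dec T x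
    outs = filter (⟶-dec T x) xs
    ins  = filter ∁x⟶? xs
    dominated : ∀ {y} → x ≢ y → ¬ x ⟶ y → y ⟶ x
    dominated {y} x≢y x↛y with compare x y
    ... | tri< x⟶y _ _ = contradiction x⟶y x↛y
    ... | tri≈ _ x≡y _ = contradiction x≡y x≢y
    ... | tri> _ _ y⟶x = y⟶x
    2^k≤ins : 2 ℕ.^ k ≤ length ins
    2^k≤ins = ℕ.+-cancelˡ-≤ (2 ℕ.^ k) _ _ (begin
      2 ℕ.^ k ℕ.+ 2 ℕ.^ k                ≡⟨ cong (2 ℕ.^ k ℕ.+_) (ℕ.+-identityʳ (2 ℕ.^ k)) ⟨
      2 ℕ.^ suc k                        ≤⟨ 2^k≤xs ⟩
      suc (length xs)                    ≡⟨ cong suc (length-filter-∁ (⟶-dec T x) xs) ⟨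
      -- Since `outs` falls short of `2 ^ k`, it can absorb the 1 that counts `x`.
      suc (length outs) ℕ.+ length ins   ≤⟨ ℕ.+-monoˡ-≤ (length ins) (ℕ.≰⇒> 2^k≰outs) ⟩
      2 ℕ.^ k ℕ.+ length ins             ∎)
      where open ℕ.≤-Reasoning

  linear-↪ : .{{_ : NonZero n}} → ∀ {m} → m ≤ suc ⌊log₂ n ⌋ → linear m ↪ T
  linear-↪ m≤1+log =
    let zs , zs-chain , _ , |zs| = chain ⌊log₂ n ⌋ {λ _ → ⊤} (allFin n) (Unique.allFin⁺ n)
          (All.universal (λ _ → tt) (allFin n))
          (subst (2 ℕ.^ ⌊log₂ n ⌋ ≤_) (sym (length-tabulate {n = n} id)) (2^⌊log₂n⌋≤n n))
        m≤|zs| = subst (_ ≤_) (sym |zs|) m≤1+log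
    in mono⇒↪ (linear _) T λ {i} {j} i<j → AllPairs-lookup zs-chain
         {Fin.inject≤ i m≤|zs|} {Fin.inject≤ j m≤|zs|}
         (subst₂ _<_ (sym (Fin.toℕ-inject≤ i m≤|zs|)) (sym (Fin.toℕ-inject≤ j m≤|zs|)) i<j)

  removing-all-but-log : .{{_ : NonZero n}} →
                 ∃[ k ] k ≤ n ∸ ⌊log₂ n ⌋ × UnimodularAfterRemoving T k
  removing-all-but-log =
    let h , log≤2h , 2h≤1+log = even-above ⌊log₂ n ⌋
        emb = linear-↪ 2h≤1+log
        -- The embedding itself bounds `h * 2` by `n`, which makes the subtraction exact.
        2h≤n = Fin.injective⇒≤ (emb .proj₂ .IsOrderMonomorphism.injective)
    in n ∸ h ℕ.* 2 , ℕ.∸-monoʳ-≤ n log≤2h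
     , h ℕ.* 2 , ℕ.m+[n∸m]≡n 2h≤n , linear (h ℕ.* 2) , linear-even-unimodular h , emb

-- Decidability by finite search.

-- A monotone identity already reflects domination, so U and V are the same tournament.
IsoInvariant : ∀ {ℓ} → (Tournament n → Set ℓ) → Set _
IsoInvariant {n} Q = ∀ {U V : Tournament n} → U ⟪ id ⟫ V → Q U → Q V

-- b i j ≡ zero says that i dominates j; only the values with i < j are read.
fromUpper : (Fin n → Fin n → Fin 2) → Tournament n
fromUpper {n} b = record { _⟶_ = _↝_ ; compare = cmp }
  where
  _↝_ : Rel (Fin n) 0ℓ
  i ↝ j = (i Fin.< j × b i j ≡ zero) ⊎ (j Fin.< i × b j i ≢ zero)
  cmp : Trichotomous _≡_ _↝_
  cmp i j with Fin.<-cmp i j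
  ... | tri≈ i≮j i≡j j≮i = tri≈
    (λ { (inj₁ (i<j , _)) → i≮j i<j ; (inj₂ (j<i , _)) → j≮i j<i }) i≡j
    (λ { (inj₁ (j<i , _)) → j≮i j<i ; (inj₂ (i<j , _)) → i≮j i<j })
  ... | tri< i<j i≢j j≮i with b i j Fin.≟ zero
  ...   | yes b≡0 = tri< (inj₁ (i<j , b≡0)) i≢j
    λ { (inj₁ (j<i , _)) → j≮i j<i ; (inj₂ (_ , b≢0)) → b≢0 b≡0 }
  ...   | no  b≢0 = tri>
    (λ { (inj₁ (_ , b≡0)) → b≢0 b≡0 ; (inj₂ (j<i , _)) → j≮i j<i }) i≢j (inj₂ (i<j , b≢0))
  cmp i j | tri> i≮j i≢j j<i with b j i Fin.≟ zero
  ...   | yes b≡0 = tri>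
    (λ { (inj₁ (i<j , _)) → i≮j i<j ; (inj₂ (_ , b≢0)) → b≢0 b≡0 }) i≢j (inj₁ (j<i , b≡0))
  ...   | no  b≢0 = tri< (inj₂ (j<i , b≢0)) i≢j
    λ { (inj₁ (_ , b≡0)) → b≢0 b≡0 ; (inj₂ (i<j , _)) → i≮j i<j }

-- The code packs a table of bits: `n` digits in base `2 ^ n`, one per row, each made of `n` bits.
decode : Fin ((2 ℕ.^ n) ℕ.^ n) → Tournament n
decode {n} c = fromUpper λ i j → finToFun (finToFun {2 ℕ.^ n} {n} c i) j

-- Domination takes values in `Set`, so completeness is stated up to a monotone identity rather than
-- equality.
decode-complete : (U : Tournament n) → ∃[ c ] U ⟪ id ⟫ decode c
decode-complete {n} U = funToFin (funToFin ∘ bit) , mono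
  where
  open Tournament U
  bit : Fin n → Fin n → Fin 2
  bit i j with ⟶-dec U i j
  ... | yes _ = zero
  ... | no  _ = suc zero
  decoded : ∀ i j → finToFun (finToFun (funToFin (funToFin ∘ bit)) i) j ≡ bit i j
  decoded i j = trans (cong (λ c → finToFun c j) (Fin.finToFun-funToFin (funToFin ∘ bit) i))
                      (Fin.finToFun-funToFin (bit i) j)
  bit-⟶ : ∀ {i j} → i ⟶ j → bit i j ≡ zero
  bit-⟶ {i} {j} i⟶j with ⟶-dec U i j
  ... | yes _   = refl
  ... | no  i↛j = contradiction i⟶j i↛j
  bit-⟵ : ∀ {i j} → j ⟶ i → bit i j ≢ zero
  bit-⟵ {i} {j} j⟶i with ⟶-dec U i j
  ... | yes i⟶j = contradiction j⟶i (asym U i⟶j)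
  ... | no  _   = λ ()
  mono : U ⟪ id ⟫ decode (funToFin (funToFin ∘ bit))
  mono {i} {j} i⟶j with Fin.<-cmp i j
  ... | tri< i<j _ _ = inj₁ (i<j , trans (decoded i j) (bit-⟶ i⟶j))
  ... | tri≈ _ refl _ = contradiction i⟶j (irrefl U)
  ... | tri> _ _ j<i = inj₂ (j<i , bit-⟵ i⟶j ∘ trans (sym (decoded j i)))

-- Invariance moves a witness to its decoded copy, so searching the codes loses nothing.
∃-tournament? : ∀ {ℓ} {Q : Tournament n → Set ℓ} → IsoInvariant Q →
                (∀ U → Dec (Q U)) → Dec (∃[ U ] Q U)
∃-tournament? inv Q? = map′
  (λ (c , q) → decode c , q)
  (λ (U , q) → let c , U≅c = decode-complete U in c , inv {U} {decode c} U≅c q)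
  (Fin.any? (Q? ∘ decode))

-- Vertex maps are coded by numbers, and testing preservation suffices by `mono⇒↪`.
_↪?_ : (S : Tournament m) (T : Tournament n) → Dec (S ↪ T)
_↪?_ {m} {n} S T = map′
  (λ (c , mono) → mono⇒↪ S T (mono _ _))
  (λ emb@(f , _) → funToFin f , λ i j i⟶j →
    subst₂ T._⟶_ (sym (Fin.finToFun-funToFin f i)) (sym (Fin.finToFun-funToFin f j))
      (↪⇒mono {S = S} {T} emb i⟶j))
  (Fin.any? λ c → Fin.all? λ i → Fin.all? λ j →
    ⟶-dec S i j →-dec ⟶-dec T (finToFun {n} {m} c i) (finToFun c j))
  where
  module S = Tournament S
  module T = Tournament T

Unimodular-invariant : IsoInvariant (Unimodular {n})
Unimodular-invariant {U = U} {V} U≅V = trans (sym (det-cong (skew-mono U V {id} U≅V)))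

↪-trans : {R : Tournament w} {S : Tournament m} {T : Tournament n} → R ↪ S → S ↪ T → R ↪ T
↪-trans {R = R} {S} {T} R↪S S↪T =
  mono⇒↪ R T (↪⇒mono {S = S} {T} S↪T ∘ ↪⇒mono {S = R} {S} R↪S)

iso⇒↩ : {U V : Tournament n} → U ⟪ id ⟫ V → V ↪ U
iso⇒↩ {U = U} {V} U≅V = mono⇒↪ V U {id} (mono⇒cancel U V U≅V)

Unimodular? : (T : Tournament n) → Dec (Unimodular T)
Unimodular? T = det (skewAdjacency T) ℤ.≟ 1ℤ

adding? : (T : Tournament n) → Decidable (UnimodularAfterAdding T)
adding? T k = ∃-tournament?
  (λ {U} {V} U≅V (det≡1 , T↪U) → Unimodular-invariant {U = U} {V} U≅V det≡1
    , ↪-trans {R = T} {U} {V} T↪U (mono⇒↪ U V U≅V))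
  (λ U → Unimodular? U ×-dec (T ↪? U))

removing? : (T : Tournament n) → Decidable (UnimodularAfterRemoving T)
removing? {n} T k = map′
  (λ (m , _ , r) → m , r)
  (λ (m , m+k≡n , r) → m , s≤s (ℕ.m+n≤o⇒m≤o m (ℕ.≤-reflexive m+k≡n)) , m+k≡n , r)
  -- At most `n` vertices can remain, so `m` ranges below `suc n`.
  (ℕ.anyUpTo? (λ m → (m ℕ.+ k ℕ.≟ n) ×-dec ∃-tournament?
    (λ {U} {V} U≅V (det≡1 , U↪T) → Unimodular-invariant {U = U} {V} U≅V det≡1
      , ↪-trans {R = V} {U} {T} (iso⇒↩ {U = U} {V} U≅V) U↪T)
    (λ U → Unimodular? U ×-dec (U ↪? T))) (suc n))

-- Existence of the minima and the two bounds.

-- Well-founded descent passes to a smaller witness; when the bounded search finds none, the current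
-- one is least.
smallest : ∀ {ℓ} {P : Pred ℕ ℓ} → Decidable P → ∀ k → P k → ∃[ l ] IsSmallest P l
smallest {P = P} P? = <-rec _ λ k rec Pk → step k rec Pk (ℕ.anyUpTo? P? k)
  where
  step : ∀ k → (∀ {j} → j < k → P j → ∃[ l ] IsSmallest P l) → P k →
         Dec (∃[ j ] j < k × P j) → ∃[ l ] IsSmallest P l
  step k rec Pk (yes (j , j<k , Pj)) = rec j<k Pj
  step k rec Pk (no ¬below) = k , Pk , λ j Pj → ℕ.≮⇒≥ λ j<k → ¬below (j , j<k , Pj)

theorem5p1 : ∀ (n : ℕ) .{{_ : NonZero n}} (T : Tournament n) → ∃[ u⁺ ] ∃[ u⁻ ] (T HasU⁺ u⁺ × T HasU⁻ u⁻ × u⁺ ≤ u⁻ × u⁺ ≤ n ∸ ⌊log₂ n ⌋)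
theorem5p1 n T =
  let k , k≤n∸log , removing-k = removing-all-but-log T
      u⁻ , removing-u⁻ , u⁻-min = smallest (removing? T) k removing-k
      -- Adding `u⁻` vertices works as well, which both starts the search for `u⁺` and bounds it by
      -- `u⁻`.
      adding-u⁻ = removing⇒adding T removing-u⁻
      u⁺ , adding-u⁺ , u⁺-min = smallest (adding? T) u⁻ adding-u⁻
      u⁺≤u⁻ = u⁺-min u⁻ adding-u⁻
  in u⁺ , u⁻ , (adding-u⁺ , u⁺-min) , (removing-u⁻ , u⁻-min) , u⁺≤u⁻
   , ℕ.≤-trans u⁺≤u⁻ (ℕ.≤-trans (u⁻-min k removing-k) k≤n∸log)
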